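{- Let $\sigma$ be a list of two complex numbers such that $\rho(\sigma)>0$ and $\rho(\sigma)$ occurs in $\sigma$ with multiplicity exactly $1$. Then $\sigma$ is $\mathcal{IR}$ if and only if $\sigma$ is $\mathcal{R}$.
   Context: For a list $\sigma$ of $n$ complex numbers (repeats allowed), $\rho(\sigma)$ denotes the largest absolute value of an element of $\sigma$. The list $\sigma$ is realizable ($\mathcal{R}$) if there is an $n\times n$ entrywise nonnegative matrix whose list of eigenvalues, with multiplicities, is $\sigma$; it is irreducibly realizable ($\mathcal{IR}$) if such a matrix can be chosen irreducible. A square matrix is irreducible if it is not similar by a permutation matrix to a nontrivially block triangular matrix (equivalently, its digraph is strongly connected). -}

module Defs where

open import Level using (Level) renaming (suc to lsuc)
open import Algebra.Bundles using (CommutativeRing; RawRing)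
open import Algebra.Solver.Ring.AlmostCommutativeRing using
  (fromCommutativeRing; _-Raw-AlmostCommutative⟶_)
import Algebra.Solver.Ring as RingSolver
import Algebra.Properties.Ring as RingProperties
import Algebra.Properties.Semiring.Mult.TCOptimised as SemiringMult
open import Data.Fin.Base as Fin using (Fin; toℕ; punchIn)
open import Data.Fin.Permutation using (Permutation′; _⟨$⟩ʳ_)
open import Data.List.Base as List using (List; []; _∷_)
import Data.List.Extrema as Extrema
open import Data.Integer.Base as ℤ using (ℤ)
import Data.Integer.Properties as ℤ
open import Data.Maybe.Base using (just; nothing)
import Data.Nat.Properties as ℕ
import Data.Sign.Base as Sign
open import Data.Nat.Base as ℕ using (ℕ; zero; suc)
open import Data.Product.Base using (Σ; ∃; ∃-syntax; _×_; _,_; proj₁; proj₂)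
open import Data.Sum.Base using (inj₁; inj₂)
open import Data.Vec.Base as Vec using (Vec)
open import Function.Base using (_∘_)
open import Relation.Binary.Bundles using (TotalOrder)
open import Relation.Binary.Core using (Rel)
open import Relation.Binary.Definitions using (Decidable; WeaklyDecidable)
import Relation.Binary.PropositionalEquality as ≡
open import Relation.Binary.Structures using (IsDecTotalOrder)
import Relation.Binary.Construct.NonStrictToStrict as NonStrictToStrict
open import Relation.Nullary using (¬_; yes; no)
open import Relation.Nullary.Decidable using (_×-dec_)
open import Relation.Unary using (Pred)
import Data.Fin.Properties as Fin

-- The (classical) real numbers, axiomatised up to isomorphism as a complete
-- ordered field.  Decidability of _≈_ and _≤_ is part of the structure since
-- the classical reals are meant.

record CompleteOrderedField (ℓ : Level) : Set (lsuc ℓ) where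
  infix 4 _≤_
  field
    commutativeRing : CommutativeRing ℓ ℓ

  open CommutativeRing commutativeRing public
    using ( Carrier; _≈_; _+_; _*_; -_; _-_; 0#; 1#; rawRing; ring; setoid
          ; +-comm; +-identityˡ; +-identityʳ; *-identityˡ; *-identityʳ
          ; zeroˡ; zeroʳ; *-comm; *-assoc; *-congˡ; *-congʳ; *-cong
          ; +-congˡ; +-congʳ; +-cong; -‿cong; -‿inverseʳ)

  field
    _≤_             : Rel Carrier ℓ
    isDecTotalOrder : IsDecTotalOrder _≈_ _≤_
    0≉1             : ¬ (0# ≈ 1#)
    inverse         : ∀ x → ¬ (x ≈ 0#) → ∃[ y ] x * y ≈ 1#
    +-monoˡ-≤       : ∀ z {x y} → x ≤ y → x + z ≤ y + z
    *-nonNegative   : ∀ {x y} → 0# ≤ x → 0# ≤ y → 0# ≤ x * y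

  UpperBound : Pred Carrier ℓ → Pred Carrier ℓ
  UpperBound P u = ∀ {x} → P x → x ≤ u

  IsSupremum : Pred Carrier ℓ → Pred Carrier ℓ
  IsSupremum P s = UpperBound P s × (∀ {u} → UpperBound P u → s ≤ u)

  field
    complete : ∀ (P : Pred Carrier ℓ) → ∃ P → ∃ (UpperBound P) → ∃ (IsSupremum P)

  open IsDecTotalOrder isDecTotalOrder public
    using (_≟_; _≤?_; isTotalOrder; total; antisym; ≤-respˡ-≈; ≤-respʳ-≈)
    renaming (refl to ≤-refl; trans to ≤-trans; reflexive to ≤-reflexive)
  open IsDecTotalOrder.Eq isDecTotalOrder public
    using () renaming (refl to ≈-refl; sym to ≈-sym; trans to ≈-trans)

  open NonStrictToStrict _≈_ _≤_ public using (_<_)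

  totalOrder : TotalOrder ℓ ℓ ℓ
  totalOrder = record { isTotalOrder = isTotalOrder }

-- The ring solver with integer coefficients for an arbitrary commutative ring;
-- over an abstract coefficient ring it cannot cancel terms.

module IntegerCoefficientSolver {c ℓ} (R : CommutativeRing c ℓ) where
  open CommutativeRing R
  open RingProperties ring
    using (-‿distribˡ-*; -‿distribʳ-*; -0#≈0#; -‿involutive; -‿+-comm)
  open SemiringMult semiring using (1+×; ×-homo-+; ×1-homo-*) renaming (_×_ to _×′_)
  open import Relation.Binary.Reasoning.Setoid setoid

  fromℕ : ℕ → Carrier
  fromℕ n = n ×′ 1#

  fromℤ : ℤ → Carrier
  fromℤ (ℤ.+ n)      = fromℕ n
  fromℤ (ℤ.-[1+ n ]) = - fromℕ (suc n)

  fromℤ-⊖ : ∀ m n → fromℤ (m ℤ.⊖ n) ≈ fromℕ m - fromℕ n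
  fromℤ-⊖ m zero = sym (trans (+-congˡ -0#≈0#) (+-identityʳ _))
  fromℤ-⊖ zero (suc n) = sym (+-identityˡ _)
  fromℤ-⊖ (suc m) (suc n) = begin
    fromℤ (suc m ℤ.⊖ suc n)                 ≡⟨ ≡.cong fromℤ (ℤ.[1+m]⊖[1+n]≡m⊖n m n) ⟩
    fromℤ (m ℤ.⊖ n)                         ≈⟨ fromℤ-⊖ m n ⟩
    fromℕ m - fromℕ n                       ≈⟨ +-congˡ (+-identityˡ _) ⟨
    fromℕ m + (0# - fromℕ n)                ≈⟨ +-congˡ (+-congʳ (-‿inverseʳ 1#)) ⟨
    fromℕ m + (1# - 1# - fromℕ n)           ≈⟨ +-congˡ (+-assoc _ _ _) ⟩
    fromℕ m + (1# + (- 1# - fromℕ n))       ≈⟨ +-assoc _ _ _ ⟨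
    fromℕ m + 1# + (- 1# - fromℕ n)         ≈⟨ +-cong (+-comm _ _) (-‿+-comm _ _) ⟩
    1# + fromℕ m - (1# + fromℕ n)           ≈⟨ +-cong (1+× m 1#) (-‿cong (1+× n 1#)) ⟨
    fromℕ (suc m) - fromℕ (suc n)           ∎

  fromℤ-neg : ∀ i → fromℤ (ℤ.- i) ≈ - fromℤ i
  fromℤ-neg (ℤ.+ zero)    = sym -0#≈0#
  fromℤ-neg (ℤ.+ (suc n)) = refl
  fromℤ-neg ℤ.-[1+ n ]    = sym (-‿involutive _)

  fromℤ-+ : ∀ i j → fromℤ (i ℤ.+ j) ≈ fromℤ i + fromℤ j
  fromℤ-+ (ℤ.+ m)    (ℤ.+ n)    = ×-homo-+ 1# m n
  fromℤ-+ (ℤ.+ m)    ℤ.-[1+ n ] = fromℤ-⊖ m (suc n)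
  fromℤ-+ ℤ.-[1+ m ] (ℤ.+ n)    = trans (fromℤ-⊖ n (suc m)) (+-comm _ _)
  fromℤ-+ ℤ.-[1+ m ] ℤ.-[1+ n ] = begin
    - fromℕ (suc (suc (m ℕ.+ n)))           ≡⟨ ≡.cong (λ k → - fromℕ (suc k)) (ℕ.+-suc m n) ⟨
    - fromℕ (suc m ℕ.+ suc n)               ≈⟨ -‿cong (×-homo-+ 1# (suc m) (suc n)) ⟩
    - (fromℕ (suc m) + fromℕ (suc n))       ≈⟨ -‿+-comm _ _ ⟨
    - fromℕ (suc m) - fromℕ (suc n)         ∎

  fromℤ-◃ : ∀ n → fromℤ (Sign.- ℤ.◃ n) ≈ - fromℕ n
  fromℤ-◃ zero    = sym -0#≈0#
  fromℤ-◃ (suc n) = refl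

  fromℤ-+◃ : ∀ n → fromℤ (Sign.+ ℤ.◃ n) ≈ fromℕ n
  fromℤ-+◃ zero    = refl
  fromℤ-+◃ (suc n) = refl

  fromℤ-* : ∀ i j → fromℤ (i ℤ.* j) ≈ fromℤ i * fromℤ j
  fromℤ-* (ℤ.+ m)    (ℤ.+ n)    = trans (fromℤ-+◃ (m ℕ.* n)) (×1-homo-* m n)
  fromℤ-* (ℤ.+ m)    ℤ.-[1+ n ] = begin
    fromℤ (Sign.- ℤ.◃ (m ℕ.* suc n))        ≈⟨ fromℤ-◃ (m ℕ.* suc n) ⟩
    - fromℕ (m ℕ.* suc n)                   ≈⟨ -‿cong (×1-homo-* m (suc n)) ⟩
    - (fromℕ m * fromℕ (suc n))             ≈⟨ -‿distribʳ-* _ _ ⟩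
    fromℕ m * - fromℕ (suc n)               ∎
  fromℤ-* ℤ.-[1+ m ] (ℤ.+ n)    = begin
    fromℤ (Sign.- ℤ.◃ (suc m ℕ.* n))        ≈⟨ fromℤ-◃ (suc m ℕ.* n) ⟩
    - fromℕ (suc m ℕ.* n)                   ≈⟨ -‿cong (×1-homo-* (suc m) n) ⟩
    - (fromℕ (suc m) * fromℕ n)             ≈⟨ -‿distribˡ-* _ _ ⟩
    - fromℕ (suc m) * fromℕ n               ∎
  fromℤ-* ℤ.-[1+ m ] ℤ.-[1+ n ] = begin
    fromℤ (Sign.+ ℤ.◃ (suc m ℕ.* suc n))    ≈⟨ fromℤ-+◃ (suc m ℕ.* suc n) ⟩
    fromℕ (suc m ℕ.* suc n)                 ≈⟨ ×1-homo-* (suc m) (suc n) ⟩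
    fromℕ (suc m) * fromℕ (suc n)           ≈⟨ -‿involutive _ ⟨
    - - (fromℕ (suc m) * fromℕ (suc n))     ≈⟨ -‿cong (-‿distribʳ-* _ _) ⟩
    - (fromℕ (suc m) * - fromℕ (suc n))     ≈⟨ -‿distribˡ-* _ _ ⟩
    - fromℕ (suc m) * - fromℕ (suc n)       ∎

  morphism : ℤ.+-*-rawRing -Raw-AlmostCommutative⟶ fromCommutativeRing R
  morphism = record
    { ⟦_⟧    = fromℤ
    ; +-homo = fromℤ-+
    ; *-homo = fromℤ-*
    ; -‿homo = fromℤ-neg
    ; 0-homo = refl
    ; 1-homo = refl
    }

  coefficient≟ : WeaklyDecidable (λ i j → fromℤ i ≈ fromℤ j)
  coefficient≟ i j with i ℤ.≟ j
  ... | yes i≡j = just (reflexive (≡.cong fromℤ i≡j))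
  ... | no  _   = nothing

  open RingSolver ℤ.+-*-rawRing (fromCommutativeRing R) morphism coefficient≟ public
    using (solve; _:=_; _:+_; _:*_; _:-_; :-_; con)

module SquareRoot {ℓ} (ℝ : CompleteOrderedField ℓ) where
  open CompleteOrderedField ℝ
  open IntegerCoefficientSolver commutativeRing
    using (solve; _:=_; _:+_; _:*_; _:-_; :-_; con)

  ≤⇒0≤- : ∀ {x y} → x ≤ y → 0# ≤ y - x
  ≤⇒0≤- {x} x≤y = ≤-respˡ-≈ (-‿inverseʳ x) (+-monoˡ-≤ (- x) x≤y)

  0≤-⇒≤ : ∀ {x y} → 0# ≤ y - x → x ≤ y
  0≤-⇒≤ {x} {y} p = ≤-respˡ-≈ (+-identityˡ x)
    (≤-respʳ-≈ (solve 2 (λ a b → b :- a :+ a := b) ≈-refl x y) (+-monoˡ-≤ x p))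

  +-nonNegative : ∀ {x y} → 0# ≤ x → 0# ≤ y → 0# ≤ x + y
  +-nonNegative {x} {y} p q =
    ≤-trans q (≤-respˡ-≈ (+-identityˡ y) (+-monoˡ-≤ y p))

  square-nonNegative : ∀ x → 0# ≤ x * x
  square-nonNegative x with total 0# x
  ... | inj₁ p = *-nonNegative p p
  ... | inj₂ p = ≤-respʳ-≈
    (solve 1 (λ a → (:- a) :* (:- a) := a :* a) ≈-refl x) (*-nonNegative q q)
    where
    q : 0# ≤ - x
    q = ≤-respʳ-≈ (+-identityˡ (- x)) (≤⇒0≤- p)

  0≤1 : 0# ≤ 1#
  0≤1 = ≤-respʳ-≈ (*-identityˡ 1#) (square-nonNegative 1#)

  *-zero-cancel : ∀ {x y} → ¬ (x ≈ 0#) → x * y ≈ 0# → y ≈ 0#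
  *-zero-cancel {x} {y} x≉0 xy≈0 with inverse x x≉0
  ... | i , xi≈1 = ≈-trans (≈-sym (*-identityˡ y)) (≈-trans (*-congʳ (≈-sym xi≈1))
    (≈-trans (solve 3 (λ a b c → a :* b :* c := b :* (a :* c)) ≈-refl x i y)
    (≈-trans (*-congˡ xy≈0) (zeroʳ i))))

  square-cancel-≤ : ∀ {x y} → 0# ≤ x → 0# ≤ y → x * x ≤ y * y → x ≤ y
  square-cancel-≤ {x} {y} 0≤x 0≤y x²≤y² with total x y
  ... | inj₁ x≤y = x≤y
  ... | inj₂ y≤x with (x + y) ≟ 0#
  ...   | yes x+y≈0 = ≤-trans (0≤-⇒≤ (≤-respʳ-≈ y≈0-x 0≤y)) 0≤y
    where
    y≈0-x : y ≈ 0# - x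
    y≈0-x = ≈-trans (solve 2 (λ a b → b := a :+ b :- a) ≈-refl x y) (+-congʳ x+y≈0)
  ...   | no x+y≉0 = 0≤-⇒≤ (≤-reflexive (≈-sym (*-zero-cancel x+y≉0 (antisym ≤0 0≤))))
    where
    e : (x + y) * (y - x) ≈ y * y - x * x
    e = solve 2 (λ a b → (a :+ b) :* (b :- a) := b :* b :- a :* a) ≈-refl x y
    0≤ : 0# ≤ (x + y) * (y - x)
    0≤ = ≤-respʳ-≈ (≈-sym e) (≤⇒0≤- x²≤y²)
    ≤0 : (x + y) * (y - x) ≤ 0#
    ≤0 = 0≤-⇒≤ (≤-respʳ-≈
      (solve 2 (λ a b → (a :+ b) :* (a :- b) := con (ℤ.+ 0) :- (a :+ b) :* (b :- a)) ≈-refl x y)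
      (*-nonNegative (+-nonNegative 0≤x 0≤y) (≤⇒0≤- y≤x)))

  -- With s = sup { y ≥ 0 | y² ≤ x } and k = x + 1 put y = (sk + x) / (s + k).
  -- Then y - s = (x - s²) / (s + k) and y² - x = (k² - x)(s² - x) / (s + k)²,
  -- so s² < x and x < s² both contradict the choice of s.
  sqrt-exists : ∀ x → 0# ≤ x → ∃[ s ] 0# ≤ s × s * s ≈ x
  sqrt-exists x 0≤x = s , 0≤s , s²≈x
    where
    P : Pred Carrier ℓ
    P y = 0# ≤ y × y * y ≤ x

    k : Carrier
    k = x + 1#

    0≤k : 0# ≤ k
    0≤k = +-nonNegative 0≤x 0≤1

    k²-x : Carrier
    k²-x = x * x + x + 1#

    0≤k²-x : 0# ≤ k²-x
    0≤k²-x = +-nonNegative (+-nonNegative (square-nonNegative x) 0≤x) 0≤1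

    k²-x≈ : k * k - x ≈ k²-x
    k²-x≈ = solve 1 (λ a → (a :+ con (ℤ.+ 1)) :* (a :+ con (ℤ.+ 1)) :- a
                        := a :* a :+ a :+ con (ℤ.+ 1)) ≈-refl x

    x≤k² : x ≤ k * k
    x≤k² = 0≤-⇒≤ (≤-respʳ-≈ (≈-sym k²-x≈) 0≤k²-x)

    sup : ∃ (IsSupremum P)
    sup = complete P (0# , ≤-refl , ≤-respˡ-≈ (≈-sym (zeroˡ 0#)) 0≤x)
      (k , λ { (0≤y , y²≤x) → square-cancel-≤ 0≤y 0≤k (≤-trans y²≤x x≤k²) })

    s : Carrier
    s = proj₁ sup

    s-upper : UpperBound P s
    s-upper = proj₁ (proj₂ sup)

    s-least : ∀ {u} → UpperBound P u → s ≤ u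
    s-least = proj₂ (proj₂ sup)

    0≤s : 0# ≤ s
    0≤s = s-upper (≤-refl , ≤-respˡ-≈ (≈-sym (zeroˡ 0#)) 0≤x)

    d : Carrier
    d = s + k

    0≤d : 0# ≤ d
    0≤d = +-nonNegative 0≤s 0≤k

    d≉0 : ¬ (d ≈ 0#)
    d≉0 d≈0 = 0≉1 (antisym 0≤1 (≤-respʳ-≈ d≈0 (0≤-⇒≤ (≤-respʳ-≈
      (solve 2 (λ a b → a :+ b := a :+ (b :+ con (ℤ.+ 1)) :- con (ℤ.+ 1)) ≈-refl s x)
      (+-nonNegative 0≤s 0≤x)))))

    i : Carrier
    i = proj₁ (inverse d d≉0)

    di≈1 : d * i ≈ 1#
    di≈1 = proj₂ (inverse d d≉0)

    0≤i : 0# ≤ i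
    0≤i = ≤-respʳ-≈ (≈-trans (solve 2 (λ a b → a :* (b :* b) := a :* b :* b) ≈-refl d i)
                    (≈-trans (*-congʳ di≈1) (*-identityˡ i)))
            (*-nonNegative 0≤d (square-nonNegative i))

    y : Carrier
    y = (s * k + x) * i

    0≤y : 0# ≤ y
    0≤y = *-nonNegative (+-nonNegative (*-nonNegative 0≤s 0≤k) 0≤x) 0≤i

    [y-s]d : (y - s) * d ≈ x - s * s
    [y-s]d = ≈-trans
      (solve 4 (λ s k x i → ((s :* k :+ x) :* i :- s) :* (s :+ k)
             := (s :* k :+ x) :* ((s :+ k) :* i) :- s :* (s :+ k)) ≈-refl s k x i)
      (≈-trans (+-congʳ (≈-trans (*-congˡ di≈1) (*-identityʳ _)))
      (solve 3 (λ s k x → s :* k :+ x :- s :* (s :+ k) := x :- s :* s) ≈-refl s k x))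

    y²-x : y * y - x ≈ (k²-x * (s * s - x)) * (i * i)
    y²-x = ≈-trans (+-congˡ (-‿cong x≈))
      (≈-trans (solve 4 (λ s k x i →
          (s :* k :+ x) :* i :* ((s :* k :+ x) :* i)
            :- x :* (((s :+ k) :* i) :* ((s :+ k) :* i))
          := ((k :* k :- x) :* (s :* s :- x)) :* (i :* i)) ≈-refl s k x i)
        (*-congʳ (*-congʳ k²-x≈)))
      where
      x≈ : x ≈ x * ((d * i) * (d * i))
      x≈ = ≈-sym (≈-trans (*-congˡ (≈-trans (*-cong di≈1 di≈1) (*-identityˡ 1#)))
                          (*-identityʳ x))

    s²≈x : s * s ≈ x
    s²≈x with total (s * s) x
    ... | inj₁ s²≤x = antisym s²≤x (0≤-⇒≤ (≤-respʳ-≈ e (*-nonNegative (≤⇒0≤- y≤s) 0≤d)))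
      where
      y²≤x : y * y ≤ x
      y²≤x = 0≤-⇒≤ (≤-respʳ-≈
        (≈-trans (solve 4 (λ a b c j → (a :* (c :- b)) :* j := :- ((a :* (b :- c)) :* j))
                   ≈-refl k²-x (s * s) x (i * i))
        (≈-trans (-‿cong (≈-sym y²-x))
                 (solve 2 (λ a b → :- (a :- b) := b :- a) ≈-refl (y * y) x)))
        (*-nonNegative (*-nonNegative 0≤k²-x (≤⇒0≤- s²≤x)) (square-nonNegative i)))
      y≤s : y ≤ s
      y≤s = s-upper (0≤y , y²≤x)
      e : (s - y) * d ≈ s * s - x
      e = ≈-trans (solve 3 (λ a b c → (a :- b) :* c := :- ((b :- a) :* c)) ≈-refl s y d)
         (≈-trans (-‿cong [y-s]d)
                  (solve 2 (λ a b → :- (a :- b) := b :- a) ≈-refl x (s * s)))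
    ... | inj₂ x≤s² = antisym
        (0≤-⇒≤ (≤-respʳ-≈ [y-s]d (*-nonNegative (≤⇒0≤- s≤y) 0≤d))) x≤s²
      where
      x≤y² : x ≤ y * y
      x≤y² = 0≤-⇒≤ (≤-respʳ-≈ (≈-sym y²-x)
        (*-nonNegative (*-nonNegative 0≤k²-x (≤⇒0≤- x≤s²)) (square-nonNegative i)))
      s≤y : s ≤ y
      s≤y = s-least (λ { (0≤t , t²≤x) → square-cancel-≤ 0≤t 0≤y (≤-trans t²≤x x≤y²) })

  √ : ∀ x → 0# ≤ x → Carrier
  √ x 0≤x = proj₁ (sqrt-exists x 0≤x)

-- Univariate polynomials as coefficient lists, constant term first.  Two lists
-- are identified when they agree up to trailing zeros.

module Polynomial {c ℓ} (R : RawRing c ℓ) where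
  private module R = RawRing R
  open R using (Carrier; 0#; 1#)

  Poly : Set c
  Poly = List Carrier

  coeff : Poly → ℕ → Carrier
  coeff []      _       = 0#
  coeff (a ∷ p) zero    = a
  coeff (a ∷ p) (suc k) = coeff p k

  infix  4 _≈ₚ_
  infixl 6 _+ₚ_
  infixl 7 _*ₚ_

  _≈ₚ_ : Rel Poly ℓ
  p ≈ₚ q = ∀ k → coeff p k R.≈ coeff q k

  _+ₚ_ : Poly → Poly → Poly
  []      +ₚ q       = q
  (a ∷ p) +ₚ []      = a ∷ p
  (a ∷ p) +ₚ (b ∷ q) = (a R.+ b) ∷ (p +ₚ q)

  _*ₚ_ : Poly → Poly → Poly
  []      *ₚ q = []
  (a ∷ p) *ₚ q = List.map (a R.*_) q +ₚ (0# ∷ (p *ₚ q))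

  constant : Carrier → Poly
  constant a = a ∷ []

  X : Poly
  X = 0# ∷ 1# ∷ []

  polyRawRing : RawRing c ℓ
  polyRawRing = record
    { Carrier = Poly
    ; _≈_     = _≈ₚ_
    ; _+_     = _+ₚ_
    ; _*_     = _*ₚ_
    ; -_      = List.map (λ a → R.- a)
    ; 0#      = []
    ; 1#      = constant 1#
    }

Matrix : ∀ {a} → Set a → ℕ → Set a
Matrix A n = Fin n → Fin n → A

module Determinant {c ℓ} (R : RawRing c ℓ) where
  open RawRing R

  alternatingSum : ∀ {n} → (Fin n → Carrier) → Carrier
  alternatingSum {zero}  f = 0#
  alternatingSum {suc n} f = f Fin.zero + (- alternatingSum (f ∘ Fin.suc))

  -- Laplace expansion along the first row.
  det : ∀ {n} → Matrix Carrier n → Carrier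
  det {zero}  A = 1#
  det {suc n} A = alternatingSum λ j →
    A Fin.zero j * det (λ i k → A (Fin.suc i) (punchIn j k))

module CharacteristicPolynomial {c ℓ} (R : RawRing c ℓ) where
  open RawRing R using (Carrier)
  open Polynomial R
  open RawRing polyRawRing using (0#; 1#; _+_; _*_; -_)
  open Determinant polyRawRing

  X·I : ∀ {n} → Matrix Poly n
  X·I i j with i Fin.≟ j
  ... | yes _ = X
  ... | no  _ = 0#

  charPoly : ∀ {n} → Matrix Carrier n → Poly
  charPoly A = det (λ i j → X·I i j + (- constant (A i j)))

  ∏[X-_] : ∀ {n} → Vec Carrier n → Poly
  ∏[X- σ ] = Vec.foldr′ (λ z p → (X + (- constant z)) * p) 1# σ

module Realizability {ℓ} (ℝ : CompleteOrderedField ℓ) where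
  open CompleteOrderedField ℝ
  open SquareRoot ℝ

  infix 5 _+i_
  record ℂ : Set ℓ where
    constructor _+i_
    field
      re : Carrier
      im : Carrier
  open ℂ public

  ofReal : Carrier → ℂ
  ofReal x = x +i 0#

  infix 4 _≈ℂ_ _≟ℂ_
  _≈ℂ_ : Rel ℂ ℓ
  z ≈ℂ w = re z ≈ re w × im z ≈ im w

  _≟ℂ_ : Decidable _≈ℂ_
  z ≟ℂ w = (re z ≟ re w) ×-dec (im z ≟ im w)

  ℂ-rawRing : RawRing ℓ ℓ
  ℂ-rawRing = record
    { Carrier = ℂ
    ; _≈_     = _≈ℂ_
    ; _+_     = λ z w → re z + re w +i im z + im w
    ; _*_     = λ z w → re z * re w - im z * im w +i re z * im w + im z * re w
    ; -_      = λ z → - re z +i - im z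
    ; 0#      = ofReal 0#
    ; 1#      = ofReal 1#
    }

  ∣_∣ : ℂ → Carrier
  ∣ z ∣ = √ (re z * re z + im z * im z)
            (+-nonNegative (square-nonNegative (re z)) (square-nonNegative (im z)))

  -- Absolute values are nonnegative, so the default 0# only matters for the
  -- empty list.
  ρ : ∀ {n} → Vec ℂ n → Carrier
  ρ σ = Extrema.max totalOrder 0# (Vec.toList (Vec.map ∣_∣ σ))

  multiplicity : ∀ {n} → ℂ → Vec ℂ n → ℕ
  multiplicity z σ = Vec.count (z ≟ℂ_) σ

  NonNegative : ∀ {n} → Matrix Carrier n → Set ℓ
  NonNegative A = ∀ i j → 0# ≤ A i j

  open Polynomial ℂ-rawRing using (_≈ₚ_)
  open CharacteristicPolynomial ℂ-rawRing using (charPoly; ∏[X-_])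

  -- Eigenvalues are counted with algebraic multiplicity.
  HasEigenvalues : ∀ {n} → Matrix Carrier n → Vec ℂ n → Set ℓ
  HasEigenvalues A σ = charPoly (λ i j → ofReal (A i j)) ≈ₚ ∏[X- σ ]

  -- Block upper triangular with diagonal blocks of sizes m and n - m.
  BlockTriangular : ∀ {n} → ℕ → Matrix Carrier n → Set ℓ
  BlockTriangular m A = ∀ i j → m ℕ.≤ toℕ i → toℕ j ℕ.< m → A i j ≈ 0#

  -- Permuting rows and columns by π is similarity by the permutation matrix
  -- of π.
  Reducible : ∀ {n} → Matrix Carrier n → Set ℓ
  Reducible {n} A = Σ (Permutation′ n) λ π → ∃[ m ] 0 ℕ.< m × m ℕ.< n ×
    BlockTriangular m (λ i j → A (π ⟨$⟩ʳ i) (π ⟨$⟩ʳ j))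

  Irreducible : ∀ {n} → Matrix Carrier n → Set ℓ
  Irreducible A = ¬ Reducible A

  Realizable : ∀ {n} → Vec ℂ n → Set ℓ
  Realizable {n} σ = Σ (Matrix Carrier n) λ A → NonNegative A × HasEigenvalues A σ

  IrreduciblyRealizable : ∀ {n} → Vec ℂ n → Set ℓ
  IrreduciblyRealizable {n} σ =
    Σ (Matrix Carrier n) λ A → NonNegative A × Irreducible A × HasEigenvalues A σ

{-# OPTIONS --safe #-}

-- If σ = (x , z) is realizable with x real then, the trace being real and
-- nonnegative, z is real and x + z ≥ 0.  For distinct reals x and y with
-- x + y ≥ 0, put p = (x + y) / 2 and q = (x - y) / 2; the matrix
-- [[p , 1] , [q² , p]] is nonnegative, has eigenvalues p ± q, and is irreducible
-- because both off-diagonal entries are nonzero.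
module Submission where

open import Defs
open import Data.Vec.Base using (Vec)
open import Function.Bundles using (_⇔_)
open import Relation.Binary.PropositionalEquality using (_≡_)

open import Algebra.Bundles using (CommutativeRing; RawRing)
import Algebra.Properties.Ring as RingProperties
import Algebra.Solver.Ring as RingSolver
open import Algebra.Solver.Ring.AlmostCommutativeRing using (fromCommutativeRing)
open import Data.Fin.Permutation using (_⟨$⟩ʳ_)
open import Data.Fin.Patterns using (0F; 1F)
import Data.Integer.Base as ℤ
open import Data.List.Base using ([]; _∷_)
open import Data.Nat.Base using (ℕ; suc; z≤n; s≤s)
open import Data.Product.Base using (_×_; _,_; proj₁; proj₂)
open import Data.Sum.Base using (_⊎_; inj₁; inj₂)
open import Data.Vec.Base using ([]; _∷_; count)
open import Function.Bundles using (mk⇔; module Injection)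
open import Function.Properties.Inverse using (↔⇒↣)
open import Relation.Binary.PropositionalEquality using (refl; _≢_)
open import Relation.Nullary using (¬_; yes; no; contradiction)
open import Relation.Unary using (Pred; Decidable)

count≡1⇒exactlyOne : ∀ {a p} {A : Set a} {P : Pred A p} (P? : Decidable P) x y →
  count P? (x ∷ y ∷ []) ≡ 1 → (P x × ¬ P y) ⊎ (¬ P x × P y)
count≡1⇒exactlyOne P? x y one with P? x | P? y
... | yes px | no ¬py = inj₁ (px , ¬py)
... | no ¬px | yes py = inj₂ (¬px , py)
count≡1⇒exactlyOne P? x y () | yes _ | yes _
count≡1⇒exactlyOne P? x y () | no _ | no _

-- The formulas follow `ℂ-rawRing`, but over an arbitrary raw ring, so that solver expressions can
-- serve as real and imaginary parts.
complexRawRing : ∀ {c ℓ} → RawRing c ℓ → RawRing c ℓ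
complexRawRing R = record
  { Carrier = Carrier × Carrier
  ; _≈_     = λ (x , y) (x′ , y′) → x ≈ x′ × y ≈ y′
  ; _+_     = λ (x , y) (x′ , y′) → x + x′ , y + y′
  ; _*_     = λ (x , y) (x′ , y′) → x * x′ + (- (y * y′)) , x * y′ + y * x′
  ; -_      = λ (x , y) → - x , - y
  ; 0#      = 0# , 0#
  ; 1#      = 1# , 0#
  }
  where open RawRing R

-- The definitions of charPoly and ∏[X-_] make sense over the raw ring of
-- complex numbers with solver expressions as real and imaginary parts.  Reusing
-- them there yields the expressions whose values are the actual coefficients.
module ComplexExpressions {c ℓ} (R : CommutativeRing c ℓ) where
  open IntegerCoefficientSolver R using (morphism; coefficient≟)
  open RingSolver ℤ.+-*-rawRing (fromCommutativeRing R) morphism coefficient≟ public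
    using (_:+_; _:*_; :-_; con) renaming (Polynomial to Expression)

  expressionRawRing : ℕ → RawRing _ _
  expressionRawRing n = record
    { Carrier = Expression n
    ; _≈_     = _≡_
    ; _+_     = _:+_
    ; _*_     = _:*_
    ; -_      = :-_
    ; 0#      = con (ℤ.+ 0)
    ; 1#      = con (ℤ.+ 1)
    }

  module _ {n : ℕ} where
    private ℂE = complexRawRing (expressionRawRing n)
    open Polynomial ℂE using (coeff)
    open CharacteristicPolynomial ℂE

    charPolyCoeff : ℕ → (a b c d : Expression n) → Expression n × Expression n
    charPolyCoeff k a b c d = coeff (charPoly A) k
      where
      A : Matrix (Expression n × Expression n) 2
      A 0F 0F = a , con (ℤ.+ 0)
      A 0F 1F = b , con (ℤ.+ 0)
      A 1F 0F = c , con (ℤ.+ 0)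
      A 1F 1F = d , con (ℤ.+ 0)

    productCoeff : ℕ → (x y x′ y′ : Expression n) → Expression n × Expression n
    productCoeff k x y x′ y′ = coeff ∏[X- (x , y) ∷ (x′ , y′) ∷ [] ] k

module RealizabilityOfPairs {ℓ} (ℝ : CompleteOrderedField ℓ) where
  open CompleteOrderedField ℝ
  open SquareRoot ℝ
  open Realizability ℝ
  open IntegerCoefficientSolver commutativeRing
    using (solve; _:=_; _:+_; _:*_; _:-_; :-_; con)
  open ComplexExpressions commutativeRing using (charPolyCoeff; productCoeff)
  open RingProperties ring using (-0#≈0#; -‿injective; x∙y⁻¹≈ε⇒x≈y)
  open Polynomial ℂ-rawRing using (_≈ₚ_)
  open CharacteristicPolynomial ℂ-rawRing using (charPoly; ∏[X-_])
  open RawRing ℂ-rawRing using () renaming (_+_ to _+ℂ_; _*_ to _*ℂ_; -_ to -ℂ_)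

  -- Trace, determinant and symmetric functions of two eigenvalues

  ≈ℂ-sym : ∀ {z w} → z ≈ℂ w → w ≈ℂ z
  ≈ℂ-sym (p , q) = ≈-sym p , ≈-sym q

  ≈ℂ-trans : ∀ {u v w} → u ≈ℂ v → v ≈ℂ w → u ≈ℂ w
  ≈ℂ-trans (p , q) (p′ , q′) = ≈-trans p p′ , ≈-trans q q′

  trace : Matrix Carrier 2 → Carrier
  trace A = A 0F 0F + A 1F 1F

  determinant : Matrix Carrier 2 → Carrier
  determinant A = A 0F 0F * A 1F 1F - A 0F 1F * A 1F 0F

  charPoly₂ : ∀ A → charPoly (λ i j → ofReal (A i j)) ≈ₚ
    (ofReal (determinant A) ∷ ofReal (- trace A) ∷ ofReal 1# ∷ [])
  charPoly₂ A 0 =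
    solve 4 (λ a b c d → proj₁ (charPolyCoeff 0 a b c d) := a :* d :- b :* c)
      ≈-refl (A 0F 0F) (A 0F 1F) (A 1F 0F) (A 1F 1F) ,
    solve 4 (λ a b c d → proj₂ (charPolyCoeff 0 a b c d) := con (ℤ.+ 0))
      ≈-refl (A 0F 0F) (A 0F 1F) (A 1F 0F) (A 1F 1F)
  charPoly₂ A 1 =
    solve 4 (λ a b c d → proj₁ (charPolyCoeff 1 a b c d) := :- (a :+ d))
      ≈-refl (A 0F 0F) (A 0F 1F) (A 1F 0F) (A 1F 1F) ,
    solve 4 (λ a b c d → proj₂ (charPolyCoeff 1 a b c d) := con (ℤ.+ 0))
      ≈-refl (A 0F 0F) (A 0F 1F) (A 1F 0F) (A 1F 1F)
  charPoly₂ A 2 =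
    solve 4 (λ a b c d → proj₁ (charPolyCoeff 2 a b c d) := con (ℤ.+ 1))
      ≈-refl (A 0F 0F) (A 0F 1F) (A 1F 0F) (A 1F 1F) ,
    solve 4 (λ a b c d → proj₂ (charPolyCoeff 2 a b c d) := con (ℤ.+ 0))
      ≈-refl (A 0F 0F) (A 0F 1F) (A 1F 0F) (A 1F 1F)
  -- Both lists compute to length three, so beyond degree 2 each coefficient is the default `0#`.
  charPoly₂ A (suc (suc (suc _))) = ≈-refl , ≈-refl

  product₂ : ∀ z w → ∏[X- z ∷ w ∷ [] ] ≈ₚ (z *ℂ w ∷ -ℂ (z +ℂ w) ∷ ofReal 1# ∷ [])
  product₂ (x +i y) (x′ +i y′) 0 =
    solve 4 (λ x y x′ y′ → proj₁ (productCoeff 0 x y x′ y′) := x :* x′ :- y :* y′)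
      ≈-refl x y x′ y′ ,
    solve 4 (λ x y x′ y′ → proj₂ (productCoeff 0 x y x′ y′) := x :* y′ :+ y :* x′)
      ≈-refl x y x′ y′
  product₂ (x +i y) (x′ +i y′) 1 =
    solve 4 (λ x y x′ y′ → proj₁ (productCoeff 1 x y x′ y′) := :- (x :+ x′))
      ≈-refl x y x′ y′ ,
    solve 4 (λ x y x′ y′ → proj₂ (productCoeff 1 x y x′ y′) := :- (y :+ y′))
      ≈-refl x y x′ y′
  product₂ (x +i y) (x′ +i y′) 2 =
    solve 4 (λ x y x′ y′ → proj₁ (productCoeff 2 x y x′ y′) := con (ℤ.+ 1))
      ≈-refl x y x′ y′ ,
    solve 4 (λ x y x′ y′ → proj₂ (productCoeff 2 x y x′ y′) := con (ℤ.+ 0))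
      ≈-refl x y x′ y′
  product₂ z w (suc (suc (suc _))) = ≈-refl , ≈-refl

  -- Compare the coefficients of degree 1 and cancel the sign.
  eigenvalues-sum : ∀ A {z w} → HasEigenvalues A (z ∷ w ∷ []) →
    z +ℂ w ≈ℂ ofReal (trace A)
  eigenvalues-sum A {z} {w} h =
    -‿injective (proj₁ e) , -‿injective (≈-trans (proj₂ e) (≈-sym -0#≈0#))
    where
    e : -ℂ (z +ℂ w) ≈ℂ ofReal (- trace A)
    e = ≈ℂ-trans (≈ℂ-sym (product₂ z w 1)) (≈ℂ-trans (≈ℂ-sym (h 1)) (charPoly₂ A 1))

  -- A monic quadratic is determined by its two lower coefficients, so the spectrum can be checked
  -- by trace and determinant.
  hasEigenvalues : ∀ A {z w} → z +ℂ w ≈ℂ ofReal (trace A) →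
    z *ℂ w ≈ℂ ofReal (determinant A) → HasEigenvalues A (z ∷ w ∷ [])
  hasEigenvalues A {z} {w} sum product k =
    ≈ℂ-trans (charPoly₂ A k) (≈ℂ-trans (middle k) (≈ℂ-sym (product₂ z w k)))
    where
    middle : (ofReal (determinant A) ∷ ofReal (- trace A) ∷ ofReal 1# ∷ []) ≈ₚ
             (z *ℂ w ∷ -ℂ (z +ℂ w) ∷ ofReal 1# ∷ [])
    middle 0 = ≈ℂ-sym product
    middle 1 = -‿cong (≈-sym (proj₁ sum)) ,
               ≈-trans (≈-sym -0#≈0#) (-‿cong (≈-sym (proj₂ sum)))
    middle 2 = ≈-refl , ≈-refl
    middle (suc (suc (suc _))) = ≈-refl , ≈-refl

  -- Nonnegative and irreducible matrices of order two

  trace-nonNegative : ∀ A → NonNegative A → 0# ≤ trace A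
  trace-nonNegative A A≥0 = +-nonNegative (A≥0 0F 0F) (A≥0 1F 1F)

  -- The only nontrivial block size is 1. It would make the permuted entry in position (1, 0)
  -- vanish, and that entry is off the diagonal of `A` because `π` is injective.
  offDiagonal≉0⇒irreducible : (A : Matrix Carrier 2) →
    (∀ i j → i ≢ j → ¬ A i j ≈ 0#) → Irreducible A
  offDiagonal≉0⇒irreducible A A≉0 (π , 1 , _ , _ , block) =
    A≉0 (π ⟨$⟩ʳ 1F) (π ⟨$⟩ʳ 0F)
      (λ e → contradiction (Injection.injective (↔⇒↣ π) e) λ ())
      (block 1F 0F (s≤s z≤n) (s≤s z≤n))
  offDiagonal≉0⇒irreducible A A≉0 (π , suc (suc _) , _ , s≤s (s≤s ()) , _)

  -- Halving

  2≉0 : ¬ 1# + 1# ≈ 0#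
  -- Adding 1 to `0≤1` gives 1 ≤ 1 + 1, which would become 1 ≤ 0.
  2≉0 2≈0 = 0≉1 (antisym 0≤1 (≤-respʳ-≈ 2≈0
    (≤-respˡ-≈ (+-identityˡ 1#) (+-monoˡ-≤ 1# 0≤1))))

  ½ : Carrier
  ½ = proj₁ (inverse (1# + 1#) 2≉0)

  2*½≈1 : (1# + 1#) * ½ ≈ 1#
  2*½≈1 = proj₂ (inverse (1# + 1#) 2≉0)

  halves : ∀ x → x * ½ + x * ½ ≈ x
  halves x = ≈-trans
    (solve 2 (λ x h → x :* h :+ x :* h := x :* ((con (ℤ.+ 1) :+ con (ℤ.+ 1)) :* h))
      ≈-refl x ½)
    (≈-trans (*-congˡ 2*½≈1) (*-identityʳ x))

  0≤½ : 0# ≤ ½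
  -- `½` equals `½ * ½ + ½ * ½`, a sum of squares.
  0≤½ = ≤-respʳ-≈ (halves ½) (+-nonNegative (square-nonNegative ½) (square-nonNegative ½))

  *-≉0 : ∀ {x y} → ¬ x ≈ 0# → ¬ y ≈ 0# → ¬ x * y ≈ 0#
  *-≉0 x≉0 y≉0 xy≈0 = y≉0 (*-zero-cancel x≉0 xy≈0)

  -- From realizable to irreducibly realizable

  distinctReals⇒irreduciblyRealizable : ∀ {z w} → im z ≈ 0# → im w ≈ 0# →
    ¬ re z ≈ re w → 0# ≤ re z + re w → IrreduciblyRealizable (z ∷ w ∷ [])
  distinctReals⇒irreduciblyRealizable {x +i u} {y +i v} u≈0 v≈0 x≉y 0≤x+y =
    B , B≥0 , offDiagonal≉0⇒irreducible B B≉0 , hasEigenvalues B sum product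
    where
    p q : Carrier
    p = (x + y) * ½
    q = (x - y) * ½

    -- The off-diagonal entries must have product q². Splitting it as 1 and q² keeps both
    -- nonnegative whatever the sign of `q`, so `x` and `y` need not be ordered.
    B : Matrix Carrier 2
    B 0F 0F = p
    B 0F 1F = 1#
    B 1F 0F = q * q
    B 1F 1F = p

    B≥0 : NonNegative B
    B≥0 0F 0F = *-nonNegative 0≤x+y 0≤½
    B≥0 0F 1F = 0≤1
    B≥0 1F 0F = square-nonNegative q
    B≥0 1F 1F = *-nonNegative 0≤x+y 0≤½

    q≉0 : ¬ q ≈ 0#
    q≉0 q≈0 = x≉y (x∙y⁻¹≈ε⇒x≈y x y
      (≈-trans (≈-sym (halves (x - y))) (≈-trans (+-cong q≈0 q≈0) (+-identityˡ 0#))))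

    B≉0 : ∀ i j → i ≢ j → ¬ B i j ≈ 0#
    B≉0 0F 0F 0≢0 = contradiction refl 0≢0
    B≉0 0F 1F _   = λ 1≈0 → 0≉1 (≈-sym 1≈0)
    B≉0 1F 0F _   = *-≉0 q≉0 q≉0
    B≉0 1F 1F 1≢1 = contradiction refl 1≢1

    sum : (x +i u) +ℂ (y +i v) ≈ℂ ofReal (p + p)
    sum = ≈-sym (halves (x + y)) , ≈-trans (+-cong u≈0 v≈0) (+-identityˡ 0#)

    xy≈p²-q² : x * y ≈ p * p - 1# * (q * q)
    xy≈p²-q² = ≈-sym (≈-trans
      -- The solver treats `½` as a variable `h`; grouping 4xyh² as (xh + xh)(yh + yh) lets `halves`
      -- finish.
      (solve 3 (λ x y h →
          (x :+ y) :* h :* ((x :+ y) :* h) :- con (ℤ.+ 1) :* ((x :- y) :* h :* ((x :- y) :* h))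
          := (x :* h :+ x :* h) :* (y :* h :+ y :* h)) ≈-refl x y ½)
      (*-cong (halves x) (halves y)))

    product : (x +i u) *ℂ (y +i v) ≈ℂ ofReal (p * p - 1# * (q * q))
    product =
      ≈-trans (+-congˡ (≈-trans (-‿cong (≈-trans (*-congʳ u≈0) (zeroˡ v))) -0#≈0#))
        (≈-trans (+-identityʳ (x * y)) xy≈p²-q²) ,
      ≈-trans (+-cong (≈-trans (*-congˡ v≈0) (zeroʳ x)) (≈-trans (*-congʳ u≈0) (zeroˡ y)))
        (+-identityˡ 0#)

  realizable⇒irreduciblyRealizable : ∀ {z w} → im z ≈ 0# → ¬ z ≈ℂ w →
    Realizable (z ∷ w ∷ []) → IrreduciblyRealizable (z ∷ w ∷ [])
  realizable⇒irreduciblyRealizable {z} {w} im-z≈0 z≉w (A , A≥0 , h) =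
    distinctReals⇒irreduciblyRealizable im-z≈0 im-w≈0
      -- Both imaginary parts vanish, so distinct entries must differ in their real parts.
      (λ e → z≉w (e , ≈-trans im-z≈0 (≈-sym im-w≈0)))
      (≤-respʳ-≈ (≈-sym (proj₁ s)) (trace-nonNegative A A≥0))
    where
    s : z +ℂ w ≈ℂ ofReal (trace A)
    s = eigenvalues-sum A h
    im-w≈0 : im w ≈ 0#
    im-w≈0 = ≈-trans (≈-sym (+-identityˡ (im w))) (≈-trans (+-congʳ (≈-sym im-z≈0)) (proj₂ s))

  -- Lets the entry known to be real be moved to the front, and the list be restored afterwards. It
  -- holds because sum and product are symmetric.
  swap-eigenvalues : ∀ A {z w} → HasEigenvalues A (z ∷ w ∷ []) →
    HasEigenvalues A (w ∷ z ∷ [])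
  swap-eigenvalues A {z} {w} h k =
    ≈ℂ-trans (h k) (≈ℂ-trans (product₂ z w k) (≈ℂ-trans (middle k) (≈ℂ-sym (product₂ w z k))))
    where
    middle : (z *ℂ w ∷ -ℂ (z +ℂ w) ∷ ofReal 1# ∷ []) ≈ₚ
             (w *ℂ z ∷ -ℂ (w +ℂ z) ∷ ofReal 1# ∷ [])
    middle 0 = +-cong (*-comm _ _) (-‿cong (*-comm _ _)) ,
               ≈-trans (+-comm _ _) (+-cong (*-comm _ _) (*-comm _ _))
    middle 1 = -‿cong (+-comm _ _) , -‿cong (+-comm _ _)
    middle 2 = ≈-refl , ≈-refl
    middle (suc (suc (suc _))) = ≈-refl , ≈-refl

  -- Applied with `ρ σ` for `r`. Multiplicity one gives an entry that is real, being equal to `r`,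
  -- and makes the other entry different from it.
  simpleReal⇒irreduciblyRealizable : ∀ r (σ : Vec ℂ 2) →
    multiplicity (ofReal r) σ ≡ 1 → Realizable σ → IrreduciblyRealizable σ
  simpleReal⇒irreduciblyRealizable r (z ∷ w ∷ []) simple realizable@(A , A≥0 , h)
    with count≡1⇒exactlyOne (ofReal r ≟ℂ_) z w simple
  ... | inj₁ (r≈z , r≉w) = realizable⇒irreduciblyRealizable (≈-sym (proj₂ r≈z))
    (λ z≈w → r≉w (≈ℂ-trans r≈z z≈w)) realizable
  ... | inj₂ (r≉z , r≈w) =
    let B , B≥0 , B-irreducible , h′ = realizable⇒irreduciblyRealizable
          (≈-sym (proj₂ r≈w)) (λ w≈z → r≉z (≈ℂ-trans r≈w w≈z))
          (A , A≥0 , swap-eigenvalues A h)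
    in B , B≥0 , B-irreducible , swap-eigenvalues B h′

mainTheorem1 : ∀ {ℓ} (ℝ : CompleteOrderedField ℓ) →
    let open CompleteOrderedField ℝ
        open Realizability ℝ
    in (σ : Vec ℂ 2) →
       0# < ρ σ →
       multiplicity (ofReal (ρ σ)) σ ≡ 1 →
       IrreduciblyRealizable σ ⇔ Realizable σ
mainTheorem1 ℝ σ _ simple = mk⇔
  (λ (A , A≥0 , _ , h) → A , A≥0 , h)
  (simpleReal⇒irreduciblyRealizable (ρ σ) σ simple)
  where
  open Realizability ℝ
  open RealizabilityOfPairs ℝ
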